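{- Let $X_n$ be a finite Dynkin diagram (one of $A_n,B_n,C_n,D_n,E_6,E_7,E_8,F_4,G_2$) with poset of positive roots $(\Phi_+,\le)$, and let $p$ be an antichain of $(\Phi_+,\le)$. Then in the ring $H_{X_n}$ one has $$h_p=\sum_{p\preceq q}\delta_q,$$ where the sum is over all antichains $q$ of $(\Phi_+,\le)$ such that $p\preceq q$.
   Context: $\Phi_+$ is the set of positive roots of the (irreducible, reduced, crystallographic) root system of type $X_n$, with the partial order $\alpha\le\beta$ iff $\beta-\alpha$ has non-negative coefficients in the basis of simple roots. Roots are regarded as linear forms on a real vector space $V$ of dimension $n$ (the simple roots form a basis of $V^*$). An antichain is a (possibly empty) set of pairwise incomparable elements of $\Phi_+$. For an antichain $p$, $I_p$ denotes the upper ideal of $(\Phi_+,\le)$ generated by $p$. Antichains are partially ordered by $p\preceq q$ iff $I_p\subseteq I_q$. The Shi arrangement is the collection of hyperplanes $\alpha(x)=0$ and $\alpha(x)=1$, $\alpha\in\Phi_+$; the dominant Weyl chamber is $\{x:\alpha(x)>0\ \forall\alpha\in\Phi_+\}$. Dominant regions are the connected components of the complement of the union of the Shi hyperplanes contained in the dominant chamber. It is known that antichains are in bijection with dominant regions: $p$ corresponds to the region defined by $\alpha(x)>1$ for $\alpha\in I_p$ and $0<\alpha(x)<1$ for $\alpha\in\Phi_+\setminus I_p$. $H_{X_n}$ is the ring (pointwise operations) of locally constant integer-valued functions on the union of the dominant regions. For an antichain $p$, $\delta_p\in H_{X_n}$ is the function equal to $1$ on the region corresponding to $p$ and $0$ elsewhere.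 For $\alpha\in\Phi_+$, $h_\alpha\in H_{X_n}$ is the function with $h_\alpha(x)=1$ if $\alpha(x)>1$ and $h_\alpha(x)=0$ if $\alpha(x)<1$. For an antichain $p=\{\alpha_1,\dots,\alpha_k\}$, $h_p=h_{\alpha_1}\cdots h_{\alpha_k}$ (with $h_\emptyset=1$). -}

module Defs where

open import Algebra.Bundles using (CommutativeRing; RawRing)
open import Algebra.Morphism.Structures using (IsRingMonomorphism)
import Algebra.Construct.Pointwise as Pointwise
import Algebra.Morphism.RingMonomorphism as RingMonomorphism
open import Data.Bool.Base using (Bool; true; false; if_then_else_; _∧_; _∨_)
open import Data.Empty using (⊥-elim)
open import Data.Fin.Base using (Fin; zero; suc; toℕ)
import Data.Fin.Properties as Fin
open import Data.Fin.Subset using (Subset; inside; outside; _∈_)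
open import Data.Fin.Subset.Properties using (_∈?_)
open import Data.Integer.Base as ℤ using (ℤ; 0ℤ; 1ℤ; -1ℤ; +_; -[1+_])
import Data.Integer.Properties as ℤ
open import Data.List.Base as List using (List; []; _∷_)
import Data.List.Membership.Propositional as List
open import Data.List.Relation.Unary.Unique.Propositional using (Unique)
open import Data.Nat.Base as ℕ using (ℕ; zero; suc; _≡ᵇ_)
import Data.Nat.Properties as ℕ
open import Data.Product.Base using (∃; _×_; _,_; proj₁; proj₂)
open import Data.Rational.Base as ℚ using (ℚ; 0ℚ; 1ℚ; ½; mkℚ)
import Data.Rational.Properties as ℚ
open import Data.Rational.Solver using (module +-*-Solver)
import Data.Rational.Unnormalised.Base as ℚᵘ
import Data.Rational.Unnormalised.Properties as ℚᵘ
open import Data.Sum.Base using (_⊎_; inj₁; inj₂; [_,_]′)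
open import Data.Vec.Base as Vec using (Vec; []; _∷_)
open import Data.Vec.Functional as Vector using (Vector)
open import Data.Vec.Relation.Unary.All as All using (All)
open import Function.Base using (_∘_)
open import Function.Bundles using (mk⇔)
open import Level using (0ℓ) renaming (suc to lsuc)
open import Relation.Binary.Definitions using (tri<; tri≈; tri>)
open import Relation.Binary.PropositionalEquality
  using (_≡_; _≢_; refl; sym; trans; cong; cong₂; subst)
open import Relation.Nullary using (¬_; Dec; yes; no; does)
open import Relation.Nullary.Decidable using (_×-dec_; _→-dec_; ¬?; map′; does-⇔)
open import Algebra.Properties.Group ℚ.+-0-group
  using () renaming (⁻¹-involutive to neg-involutive)

------------------------------------------------------------------------
-- Real numbers: located two-sided Dedekind cuts.  L x q means q < x and
-- U x q means x < q.  Only the ordered group structure is needed.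

record ℝ : Set₁ where
  field
    L U         : ℚ → Set
    L-inhabited : ∃ L
    U-inhabited : ∃ U
    L-lower     : ∀ {p q} → p ℚ.< q → L q → L p
    U-upper     : ∀ {p q} → p ℚ.< q → U p → U q
    L-open      : ∀ {p} → L p → ∃ λ q → p ℚ.< q × L q
    U-open      : ∀ {q} → U q → ∃ λ p → p ℚ.< q × U p
    disjoint    : ∀ {q} → ¬ (L q × U q)
    located     : ∀ {p q} → p ℚ.< q → L p ⊎ U q

open ℝ

infix 4 _<_ _#_

_<_ : ℝ → ℝ → Set
x < y = ∃ λ q → U x q × L y q

_#_ : ℝ → ℝ → Set
x # y = x < y ⊎ y < x

L<U : ∀ x {p q} → L x p → U x q → p ℚ.< q
L<U x {p} {q} Lp Uq with ℚ.<-cmp p q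
... | tri< p<q _ _ = p<q
... | tri≈ _ refl _ = ⊥-elim (disjoint x (Lp , Uq))
... | tri> _ _ q<p = ⊥-elim (disjoint x (L-lower x q<p Lp , Uq))

<-asym : ∀ {x y} → x < y → ¬ (y < x)
<-asym {x} {y} (q , Uxq , Lyq) (r , Uyr , Lxr) =
  ℚ.<-asym (L<U x Lxr Uxq) (L<U y Lyq Uyr)

fromℚ : ℚ → ℝ
fromℚ q = record
  { L           = ℚ._< q
  ; U           = q ℚ.<_
  ; L-inhabited = q ℚ.- 1ℚ , subst (q ℚ.- 1ℚ ℚ.<_) (ℚ.+-identityʳ q)
                    (ℚ.+-monoʳ-< q (ℚ.negative⁻¹ (ℚ.- 1ℚ)))
  ; U-inhabited = q ℚ.+ 1ℚ , subst (ℚ._< q ℚ.+ 1ℚ) (ℚ.+-identityʳ q)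
                    (ℚ.+-monoʳ-< q (ℚ.positive⁻¹ 1ℚ))
  ; L-lower     = ℚ.<-trans
  ; U-upper     = λ p<r q<p → ℚ.<-trans q<p p<r
  ; L-open      = λ p<q → let m , p<m , m<q = ℚ.<-dense p<q in m , p<m , m<q
  ; U-open      = λ q<p → let m , q<m , m<p = ℚ.<-dense q<p in m , m<p , q<m
  ; disjoint    = λ { (a , b) → ℚ.<-asym a b }
  ; located     = loc
  }
  where
  loc : ∀ {p r} → p ℚ.< r → p ℚ.< q ⊎ q ℚ.< r
  loc {p} {r} p<r with p ℚ.<? q
  ... | yes p<q = inj₁ p<q
  ... | no  p≮q = inj₂ (ℚ.≤-<-trans (ℚ.≮⇒≥ p≮q) p<r)

private
  nat : ℕ → ℚ
  nat zero    = 0ℚ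
  nat (suc k) = 1ℚ ℚ.+ nat k

  toℚᵘ-nat : ∀ k → ℚ.toℚᵘ (nat k) ℚᵘ.≃ ℚᵘ.mkℚᵘ (+ k) 0
  toℚᵘ-nat zero    = ℚᵘ.*≡* refl
  toℚᵘ-nat (suc k) = ℚᵘ.≃-trans (ℚ.toℚᵘ-homo-+ 1ℚ (nat k))
    (ℚᵘ.≃-trans (ℚᵘ.+-congʳ ℚᵘ.1ℚᵘ (toℚᵘ-nat k))
      (ℚᵘ.*≡* (cong (λ z → (1ℤ ℤ.+ z) ℤ.* 1ℤ) (ℤ.*-identityʳ (+ k)))))

  <-nat : ∀ p → ∃ λ k → p ℚ.< nat k
  <-nat p@(mkℚ n d _) = suc ℤ.∣ n ∣ , ℚ.toℚᵘ-cancel-<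
    (ℚᵘ.<-respʳ-≃ (ℚᵘ.≃-sym (toℚᵘ-nat (suc ℤ.∣ n ∣))) (ℚᵘ.*<* bound))
    where
    bound : n ℤ.* 1ℤ ℤ.< + suc ℤ.∣ n ∣ ℤ.* + suc d
    bound = ℤ.≤-<-trans (ℤ.≤-trans (ℤ.≤-reflexive (ℤ.*-identityʳ n)) (n≤∣n∣ n))
      (ℤ.<-≤-trans (ℤ.+<+ (ℕ.n<1+n ℤ.∣ n ∣))
        (ℤ.≤-trans (ℤ.+≤+ (ℕ.m≤m*n (suc ℤ.∣ n ∣) (suc d)))
          (ℤ.≤-reflexive (ℤ.pos-* (suc ℤ.∣ n ∣) (suc d)))))
      where
      n≤∣n∣ : ∀ n → n ℤ.≤ + ℤ.∣ n ∣
      n≤∣n∣ (+ n)    = ℤ.≤-refl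
      n≤∣n∣ -[1+ n ] = ℤ.-≤+

  archimedean : ∀ q d → 0ℚ ℚ.< d → ∃ λ k → q ℚ.< nat k ℚ.* d
  archimedean q d 0<d = k , subst (ℚ._< nat k ℚ.* d) eq (ℚ.*-monoˡ-<-pos d r<k)
    where
    instance
      _ = ℚ.positive 0<d
      _ = ℚ.pos⇒nonZero d
    r = q ℚ.* ℚ.1/ d
    k = proj₁ (<-nat r)
    r<k = proj₂ (<-nat r)
    eq : r ℚ.* d ≡ q
    eq = trans (ℚ.*-assoc q (ℚ.1/ d) d)
      (trans (cong (q ℚ.*_) (ℚ.*-inverseˡ d)) (ℚ.*-identityʳ q))

  p<p+d : ∀ p {d} → 0ℚ ℚ.< d → p ℚ.< p ℚ.+ d
  p<p+d p {d} 0<d = subst (ℚ._< p ℚ.+ d) (ℚ.+-identityʳ p) (ℚ.+-monoʳ-< p 0<d)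

  a+[c-a]≡c : ∀ a c → a ℚ.+ (c ℚ.- a) ≡ c
  a+[c-a]≡c = solve 2 (λ a c → a :+ (c :- a) := c) refl
    where open +-*-Solver

  [a+[q-m]]+[m-a]≡q : ∀ a q m → (a ℚ.+ (q ℚ.- m)) ℚ.+ (m ℚ.- a) ≡ q
  [a+[q-m]]+[m-a]≡q = solve 3 (λ a q m → (a :+ (q :- m)) :+ (m :- a) := q) refl
    where open +-*-Solver

  -- Cuts have arbitrarily small gaps.
  approximate : ∀ x e → 0ℚ ℚ.< e → ∃ λ a → L x a × U x (a ℚ.+ e)
  approximate x e 0<e = search k a₀ La₀
    (U-upper x (subst (ℚ._< a₀ ℚ.+ nat k ℚ.* d) (a+[c-a]≡c a₀ c₀) (ℚ.+-monoʳ-< a₀ c₀-a₀<kd)) Uc₀)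
    where
    open +-*-Solver
    d = ½ ℚ.* e
    0<d : 0ℚ ℚ.< d
    0<d = ℚ.*-monoʳ-<-pos ½ 0<e
    d+d : ∀ a → (a ℚ.+ d) ℚ.+ d ≡ a ℚ.+ e
    d+d a = solve 2 (λ a e → (a :+ con ½ :* e) :+ con ½ :* e := a :+ e) refl a e
    a₀ = proj₁ (L-inhabited x)
    La₀ = proj₂ (L-inhabited x)
    c₀ = proj₁ (U-inhabited x)
    Uc₀ = proj₂ (U-inhabited x)
    k = proj₁ (archimedean (c₀ ℚ.- a₀) d 0<d)
    c₀-a₀<kd = proj₂ (archimedean (c₀ ℚ.- a₀) d 0<d)
    search : ∀ k a → L x a → U x (a ℚ.+ nat k ℚ.* d) → ∃ λ a → L x a × U x (a ℚ.+ e)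
    search zero a La Ua = ⊥-elim (disjoint x (La , subst (U x)
      (solve 2 (λ a d → a :+ con 0ℚ :* d := a) refl a d) Ua))
    search (suc k) a La Ua with located x (p<p+d (a ℚ.+ d) 0<d)
    ... | inj₁ La+d  = search k (a ℚ.+ d) La+d (subst (U x)
      (solve 3 (λ a d k → a :+ (con 1ℚ :+ k) :* d := (a :+ d) :+ k :* d) refl a d (nat k)) Ua)
    ... | inj₂ Ua+2d = a , La , subst (U x) (d+d a) Ua+2d

infixl 6 _+_

_+_ : ℝ → ℝ → ℝ
x + y = record
  { L           = L+
  ; U           = U+
  ; L-inhabited = let a , La = L-inhabited x ; b , Lb = L-inhabited y
                  in _ , a , b , La , Lb , proj₂ (L-inhabited (fromℚ (a ℚ.+ b)))
  ; U-inhabited = let c , Uc = U-inhabited x ; d , Ud = U-inhabited y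
                  in _ , c , d , Uc , Ud , proj₂ (U-inhabited (fromℚ (c ℚ.+ d)))
  ; L-lower     = λ { p<q (a , b , La , Lb , q<a+b) → a , b , La , Lb , ℚ.<-trans p<q q<a+b }
  ; U-upper     = λ { p<q (c , d , Uc , Ud , c+d<p) → c , d , Uc , Ud , ℚ.<-trans c+d<p p<q }
  ; L-open      = λ { (a , b , La , Lb , p<a+b) → let m , p<m , m<a+b = ℚ.<-dense p<a+b
                                                  in m , p<m , a , b , La , Lb , m<a+b }
  ; U-open      = λ { (c , d , Uc , Ud , c+d<q) → let m , c+d<m , m<q = ℚ.<-dense c+d<q
                                                  in m , m<q , c , d , Uc , Ud , c+d<m }
  ; disjoint    = λ { ((a , b , La , Lb , q<a+b) , (c , d , Uc , Ud , c+d<q)) →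
                      ℚ.<-asym (ℚ.<-trans q<a+b (ℚ.+-mono-< (L<U x La Uc) (L<U y Lb Ud))) c+d<q }
  ; located     = loc
  }
  where
  L+ U+ : ℚ → Set
  L+ q = ∃ λ a → ∃ λ b → L x a × L y b × q ℚ.< a ℚ.+ b
  U+ q = ∃ λ c → ∃ λ d → U x c × U y d × c ℚ.+ d ℚ.< q

  gap : ∀ {m q} → m ℚ.< q → 0ℚ ℚ.< q ℚ.- m
  gap {m} {q} m<q = subst (ℚ._< q ℚ.- m) (ℚ.+-inverseʳ m) (ℚ.+-monoˡ-< (ℚ.- m) m<q)

  lower : ∀ {a p} → L x a → L y (p ℚ.- a) → L+ p
  lower {a} {p} La Lb = let b , p-a<b , Lb′ = L-open y Lb in
    a , b , La , Lb′ , subst (ℚ._< a ℚ.+ b) (a+[c-a]≡c a p) (ℚ.+-monoʳ-< a p-a<b)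

  upper : ∀ {c e q} → U x c → U y e → c ℚ.+ e ≡ q → U+ q
  upper {c} {e} Uc Ue eq = let d , d<e , Ud = U-open y Ue in
    c , d , Uc , Ud , subst (c ℚ.+ d ℚ.<_) eq (ℚ.+-monoʳ-< c d<e)

  loc : ∀ {p q} → p ℚ.< q → L+ p ⊎ U+ q
  loc {p} {q} p<q =
    let m , p<m , m<q = ℚ.<-dense p<q
        a , La , Uc   = approximate x (q ℚ.- m) (gap m<q)
    in [ (λ Lb → inj₁ (lower La Lb)) , (λ Ud → inj₂ (upper Uc Ud ([a+[q-m]]+[m-a]≡q a q m))) ]′
         (located y (ℚ.+-monoˡ-< (ℚ.- a) p<m))

-_ : ℝ → ℝ
- x = record
  { L           = λ q → U x (ℚ.- q)
  ; U           = λ q → L x (ℚ.- q)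
  ; L-inhabited = let c , Uc = U-inhabited x in ℚ.- c , subst (U x) (sym (neg-involutive c)) Uc
  ; U-inhabited = let a , La = L-inhabited x in ℚ.- a , subst (L x) (sym (neg-involutive a)) La
  ; L-lower     = λ p<q → U-upper x (ℚ.neg-antimono-< p<q)
  ; U-upper     = λ p<q → L-lower x (ℚ.neg-antimono-< p<q)
  ; L-open      = λ {p} Up → let c , c<-p , Uc = U-open x Up in
                    ℚ.- c , subst (ℚ._< ℚ.- c) (neg-involutive p) (ℚ.neg-antimono-< c<-p)
                  , subst (U x) (sym (neg-involutive c)) Uc
  ; U-open      = λ {q} Lq → let a , -q<a , La = L-open x Lq in
                    ℚ.- a , subst (ℚ.- a ℚ.<_) (neg-involutive q) (ℚ.neg-antimono-< -q<a)
                  , subst (L x) (sym (neg-involutive a)) La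
  ; disjoint    = λ { (u , l) → disjoint x (l , u) }
  ; located     = λ p<q → [ inj₂ , inj₁ ]′ (located x (ℚ.neg-antimono-< p<q))
  }

0ℝ 1ℝ : ℝ
0ℝ = fromℚ 0ℚ
1ℝ = fromℚ 1ℚ

infixr 7 _·ℕ_ _·_

_·ℕ_ : ℕ → ℝ → ℝ
zero  ·ℕ x = 0ℝ
suc k ·ℕ x = x + k ·ℕ x

_·_ : ℤ → ℝ → ℝ
(+ k)    · x = k ·ℕ x
-[1+ k ] · x = - (suc k ·ℕ x)

------------------------------------------------------------------------
-- ℝⁿ, with the topology generated by the open boxes with rational
-- vertices

Box : ℕ → Set
Box n = Fin n → ℚ × ℚ

infix 4 _∈ᵇ_

_∈ᵇ_ : ∀ {n} → Vector ℝ n → Box n → Set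
x ∈ᵇ I = ∀ i → L (x i) (proj₁ (I i)) × U (x i) (proj₂ (I i))

linearForm : ∀ {n} → Vec ℤ n → Vector ℝ n → ℝ
linearForm α x = Vector.foldr _+_ 0ℝ (λ i → Vec.lookup α i · x i)

private
  record Near {n} (x : Vector ℝ n) (P : Vector ℝ n → Set) : Set₁ where
    constructor near
    field
      box    : Box n
      x∈box  : x ∈ᵇ box
      on-box : ∀ y → y ∈ᵇ box → P y

  L-⊔ : ∀ x {p q} → L x p → L x q → L x (p ℚ.⊔ q)
  L-⊔ x {p} {q} Lp Lq with ℚ.⊔-sel p q
  ... | inj₁ eq = subst (L x) (sym eq) Lp
  ... | inj₂ eq = subst (L x) (sym eq) Lq

  U-⊓ : ∀ x {p q} → U x p → U x q → U x (p ℚ.⊓ q)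
  U-⊓ x {p} {q} Up Uq with ℚ.⊓-sel p q
  ... | inj₁ eq = subst (U x) (sym eq) Up
  ... | inj₂ eq = subst (U x) (sym eq) Uq

  L-≤ : ∀ x {p q} → p ℚ.≤ q → L x q → L x p
  L-≤ x p≤q Lq = let r , q<r , Lr = L-open x Lq in L-lower x (ℚ.≤-<-trans p≤q q<r) Lr

  U-≤ : ∀ x {p q} → p ℚ.≤ q → U x p → U x q
  U-≤ x p≤q Up = let r , r<p , Ur = U-open x Up in U-upper x (ℚ.<-≤-trans r<p p≤q) Ur

  module _ {n : ℕ} {x : Vector ℝ n} where

    near-all : ∀ {P : Vector ℝ n → Set} → (∀ y → P y) → Near x P
    near-all f = near (λ i → proj₁ (L-inhabited (x i)) , proj₁ (U-inhabited (x i)))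
                      (λ i → proj₂ (L-inhabited (x i)) , proj₂ (U-inhabited (x i)))
                      (λ y _ → f y)

    near-map : ∀ {P Q : Vector ℝ n → Set} → (∀ y → P y → Q y) → Near x P → Near x Q
    near-map f (near I x∈I p) = near I x∈I λ y y∈I → f y (p y y∈I)

    near-× : ∀ {P Q : Vector ℝ n → Set} → Near x P → Near x Q → Near x (λ y → P y × Q y)
    near-× (near I x∈I p) (near J x∈J q) = near
      (λ i → a i ℚ.⊔ c i , b i ℚ.⊓ d i)
      (λ i → L-⊔ (x i) (proj₁ (x∈I i)) (proj₁ (x∈J i)) , U-⊓ (x i) (proj₂ (x∈I i)) (proj₂ (x∈J i)))
      λ y y∈ → p y (λ i → L-≤ (y i) (ℚ.p≤p⊔q (a i) (c i)) (proj₁ (y∈ i))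
                        , U-≤ (y i) (ℚ.p⊓q≤p (b i) (d i)) (proj₂ (y∈ i)))
             , q y (λ i → L-≤ (y i) (ℚ.p≤q⊔p (a i) (c i)) (proj₁ (y∈ i))
                        , U-≤ (y i) (ℚ.p⊓q≤q (b i) (d i)) (proj₂ (y∈ i)))
      where
      a = λ i → proj₁ (I i)
      b = λ i → proj₂ (I i)
      c = λ i → proj₁ (J i)
      d = λ i → proj₂ (J i)

    near-∀ : ∀ {m} {P : Fin m → Vector ℝ n → Set} →
             (∀ i → Near x (P i)) → Near x (λ y → ∀ i → P i y)
    near-∀ {zero}  f = near-all λ _ ()
    near-∀ {suc m} f = near-map (λ { y (p , q) zero → p ; y (p , q) (suc i) → q i })
                                (near-× (f zero) (near-∀ (f ∘ suc)))

  Continuous : ∀ {n} → (Vector ℝ n → ℝ) → Set₁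
  Continuous F = ∀ x → (∀ {q} → L (F x) q → Near x (λ y → L (F y) q))
                     × (∀ {q} → U (F x) q → Near x (λ y → U (F y) q))

  module _ {n : ℕ} where

    cont-proj : ∀ i → Continuous {n} (λ x → x i)
    cont-proj i x =
        (λ {q} Lq → let c , Uc = U-inhabited (x i) in
           near-map {P = λ y → L (y i) q × U (y i) c} (λ _ → proj₁) (near-coord Lq Uc))
      , (λ {q} Uq → let a , La = L-inhabited (x i) in
           near-map {P = λ y → L (y i) a × U (y i) q} (λ _ → proj₂) (near-coord La Uq))
      where
      near-coord : ∀ {a c} → L (x i) a → U (x i) c → Near x (λ y → L (y i) a × U (y i) c)
      near-coord {a} {c} La Uc = near I x∈I λ y y∈I → at-i y (y∈I i)
        where
        I : Box n
        I j with i Fin.≟ j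
        ... | yes _ = a , c
        ... | no  _ = proj₁ (L-inhabited (x j)) , proj₁ (U-inhabited (x j))
        x∈I : x ∈ᵇ I
        x∈I j with i Fin.≟ j
        ... | yes refl = La , Uc
        ... | no  _    = proj₂ (L-inhabited (x j)) , proj₂ (U-inhabited (x j))
        at-i : ∀ y → L (y i) (proj₁ (I i)) × U (y i) (proj₂ (I i)) → L (y i) a × U (y i) c
        at-i y p with i Fin.≟ i
        ... | yes _   = p
        ... | no  i≢i = ⊥-elim (i≢i refl)

    cont-const : ∀ r → Continuous {n} (λ _ → r)
    cont-const r x = (λ Lq → near-all λ _ → Lq) , (λ Uq → near-all λ _ → Uq)

    cont-+ : ∀ {F G : Vector ℝ n → ℝ} → Continuous F → Continuous G → Continuous (λ x → F x + G x)
    cont-+ f g x =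
        (λ { (a , b , La , Lb , q<a+b) →
             near-map (λ { y (La , Lb) → a , b , La , Lb , q<a+b })
                      (near-× (proj₁ (f x) La) (proj₁ (g x) Lb)) })
      , (λ { (c , d , Uc , Ud , c+d<q) →
             near-map (λ { y (Uc , Ud) → c , d , Uc , Ud , c+d<q })
                      (near-× (proj₂ (f x) Uc) (proj₂ (g x) Ud)) })

    cont-neg : ∀ {F : Vector ℝ n → ℝ} → Continuous F → Continuous (λ x → - F x)
    cont-neg f x = proj₂ (f x) , proj₁ (f x)

    cont-·ℕ : ∀ k {F : Vector ℝ n → ℝ} → Continuous F → Continuous (λ x → k ·ℕ F x)
    cont-·ℕ zero        f = cont-const 0ℝ
    cont-·ℕ (suc k) {F} f = cont-+ {F} {λ x → k ·ℕ F x} f (cont-·ℕ k {F} f)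

    cont-· : ∀ z {F : Vector ℝ n → ℝ} → Continuous F → Continuous (λ x → z · F x)
    cont-· (+ k)    {F} f = cont-·ℕ k {F} f
    cont-· -[1+ k ] {F} f = cont-neg {λ x → suc k ·ℕ F x} (cont-·ℕ (suc k) {F} f)

    cont-Σ : ∀ {m} (F : Fin m → Vector ℝ n → ℝ) → (∀ i → Continuous (F i)) →
             Continuous (λ x → Vector.foldr _+_ 0ℝ (λ i → F i x))
    cont-Σ {zero}  F f = cont-const 0ℝ
    cont-Σ {suc m} F f = cont-+ {F zero} {λ x → Vector.foldr _+_ 0ℝ (λ i → F (suc i) x)}
                              (f zero) (cont-Σ (F ∘ suc) (f ∘ suc))

    cont-linearForm : ∀ α → Continuous {n} (linearForm α)
    cont-linearForm α = cont-Σ (λ i x → Vec.lookup α i · x i)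
                               (λ i → cont-· (Vec.lookup α i) (cont-proj i))

    near-> : ∀ {F x r} → Continuous {n} F → r < F x → Near x (λ y → r < F y)
    near-> f (q , Uq , Lq) = near-map (λ y Lq → q , Uq , Lq) (proj₁ (f _) Lq)

    near-< : ∀ {F x r} → Continuous {n} F → F x < r → Near x (λ y → F y < r)
    near-< f (q , Uq , Lq) = near-map (λ y Uq → q , Uq , Lq) (proj₂ (f _) Uq)

------------------------------------------------------------------------
-- Dynkin diagrams.  Nodes are numbered from 0, otherwise as in Bourbaki.

data DynkinType : Set where
  A  : (n : ℕ) → 1 ℕ.≤ n → DynkinType
  B  : (n : ℕ) → 2 ℕ.≤ n → DynkinType
  C  : (n : ℕ) → 2 ℕ.≤ n → DynkinType
  D  : (n : ℕ) → 3 ℕ.≤ n → DynkinType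
  E₆ E₇ E₈ F₄ G₂ : DynkinType

rank : DynkinType → ℕ
rank (A n _) = n
rank (B n _) = n
rank (C n _) = n
rank (D n _) = n
rank E₆      = 6
rank E₇      = 7
rank E₈      = 8
rank F₄      = 4
rank G₂      = 2

-- The Cartan matrix of a diagram with only simple edges, each given
-- once, from its smaller to its larger node.
simplyLaced : (ℕ → ℕ → Bool) → ℕ → ℕ → ℤ
simplyLaced edge i j =
  if i ≡ᵇ j then + 2 else if edge i j ∨ edge j i then -1ℤ else 0ℤ

edgeA : ℕ → ℕ → Bool
edgeA i j = suc i ≡ᵇ j

edgeD : ℕ → ℕ → ℕ → Bool
edgeD n i j = if suc j ≡ᵇ n then 3 ℕ.+ i ≡ᵇ n else suc i ≡ᵇ j

edgeE : ℕ → ℕ → Bool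
edgeE 0             j = j ≡ᵇ 2
edgeE 1             j = j ≡ᵇ 3
edgeE i@(suc (suc _)) j = suc i ≡ᵇ j

-- The entry at i, j is ⟨αᵢ, αⱼ^∨⟩, so the entry -2 or -3 of a multiple
-- edge sits in the row of its long root.
cartanEntry : DynkinType → ℕ → ℕ → ℤ
cartanEntry (A n _) i j = simplyLaced edgeA i j
cartanEntry (B n _) i j =
  if (suc i ≡ᵇ j) ∧ (suc j ≡ᵇ n) then ℤ.- (+ 2) else simplyLaced edgeA i j
cartanEntry (C n _) i j =
  if (suc j ≡ᵇ i) ∧ (suc i ≡ᵇ n) then ℤ.- (+ 2) else simplyLaced edgeA i j
cartanEntry (D n _) i j = simplyLaced (edgeD n) i j
cartanEntry E₆      i j = simplyLaced edgeE i j
cartanEntry E₇      i j = simplyLaced edgeE i j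
cartanEntry E₈      i j = simplyLaced edgeE i j
cartanEntry F₄      1 2 = ℤ.- (+ 2)
cartanEntry F₄      i j = simplyLaced edgeA i j
cartanEntry G₂      1 0 = ℤ.- (+ 3)
cartanEntry G₂      i j = simplyLaced edgeA i j

cartan : (X : DynkinType) → Fin (rank X) → Fin (rank X) → ℤ
cartan X i j = cartanEntry X (toℕ i) (toℕ j)

------------------------------------------------------------------------
-- Root systems

infixl 6 _⊖_
infixr 7 _⊛_

_⊖_ : ∀ {n} → Vec ℤ n → Vec ℤ n → Vec ℤ n
_⊖_ = Vec.zipWith ℤ._-_

_⊛_ : ∀ {n} → ℤ → Vec ℤ n → Vec ℤ n
c ⊛ α = Vec.map (c ℤ.*_) α

⟨_,_⟩ : ∀ {n} → Vec ℤ n → Vec ℤ n → ℤ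
⟨ α , φ ⟩ = Vec.foldr′ ℤ._+_ 0ℤ (Vec.zipWith ℤ._*_ α φ)

simple : ∀ {n} → Fin n → Vec ℤ n
simple i = Vec.tabulate λ j → if does (i Fin.≟ j) then 1ℤ else 0ℤ

NonNegative : ∀ {n} → Vec ℤ n → Set
NonNegative = All (0ℤ ℤ.≤_)

nonNegative? : ∀ {n} (α : Vec ℤ n) → Dec (NonNegative α)
nonNegative? = All.all? (0ℤ ℤ.≤?_)

-- A reduced crystallographic root system with a base whose Cartan matrix
-- is that of X (hence irreducible).  Roots are given by their integer
-- coefficients in the base, so that the simple roots are the standard
-- basis vectors; a coroot is given by its values on the simple roots, and
-- ⟨ β , coroot α ⟩ is the Cartan integer of β and α.  The values of
-- coroot outside of roots are irrelevant.  Since roots are integer vectors,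
-- reducedness may be stated with an integer relation of proportionality.
record RootSystem (X : DynkinType) : Set where
  field
    roots       : List (Vec ℤ (rank X))
    unique      : Unique roots
    coroot      : Vec ℤ (rank X) → Vec ℤ (rank X)
    ⟨α,α^∨⟩≡2   : ∀ {α} → α List.∈ roots → ⟨ α , coroot α ⟩ ≡ + 2
    reflection  : ∀ {α β} → α List.∈ roots → β List.∈ roots →
                  β ⊖ ⟨ β , coroot α ⟩ ⊛ α List.∈ roots
    reduced     : ∀ {α β c d} → α List.∈ roots → β List.∈ roots →
                  c ≢ 0ℤ → c ⊛ β ≡ d ⊛ α → β ≡ α ⊎ β ≡ -1ℤ ⊛ α
    simple∈     : ∀ i → simple i List.∈ roots
    signed      : ∀ {α} → α List.∈ roots → NonNegative α ⊎ NonNegative (-1ℤ ⊛ α)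
    cartan≡     : ∀ i j → ⟨ simple i , coroot (simple j) ⟩ ≡ cartan X i j

subsets : ∀ n → List (Subset n)
subsets zero    = [] ∷ []
subsets (suc n) = List.cartesianProductWith _∷_ (outside ∷ inside ∷ []) (subsets n)

module _ {X : DynkinType} (R : RootSystem X) where

  open RootSystem R

  positiveRoots : List (Vec ℤ (rank X))
  positiveRoots = List.filter nonNegative? roots

  -- Positive roots are referred to by their position in positiveRoots.
  #Φ₊ : ℕ
  #Φ₊ = List.length positiveRoots

  Φ₊ : Set
  Φ₊ = Fin #Φ₊

  root : Φ₊ → Vec ℤ (rank X)
  root = List.lookup positiveRoots

  RootLe : Φ₊ → Φ₊ → Set
  RootLe α β = NonNegative (root β ⊖ root α)

  rootLe? : ∀ α β → Dec (RootLe α β)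
  rootLe? α β = nonNegative? (root β ⊖ root α)

  IsAntichain : Subset #Φ₊ → Set
  IsAntichain p = ∀ α β → α ∈ p → β ∈ p → α ≢ β → ¬ RootLe α β

  isAntichain? : ∀ p → Dec (IsAntichain p)
  isAntichain? p = Fin.all? λ α → Fin.all? λ β →
    (α ∈? p) →-dec ((β ∈? p) →-dec (¬? (α Fin.≟ β) →-dec ¬? (rootLe? α β)))

  -- The upper ideal generated by p.
  InIdeal : Subset #Φ₊ → Φ₊ → Set
  InIdeal p β = ∃ λ α → α ∈ p × RootLe α β

  inIdeal? : ∀ p β → Dec (InIdeal p β)
  inIdeal? p β = Fin.any? λ α → (α ∈? p) ×-dec rootLe? α β

  Precedes : Subset #Φ₊ → Subset #Φ₊ → Set
  Precedes p q = ∀ β → InIdeal p β → InIdeal q β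

  precedes? : ∀ p q → Dec (Precedes p q)
  precedes? p q = Fin.all? λ β → inIdeal? p β →-dec inIdeal? q β

  antichainsAbove : Subset #Φ₊ → List (Subset #Φ₊)
  antichainsAbove p =
    List.filter (λ q → isAntichain? q ×-dec precedes? p q) (subsets #Φ₊)

  ----------------------------------------------------------------------
  -- The dominant regions of the Shi arrangement

  -- V is identified with ℝⁿ by the values of the simple roots.
  V : Set₁
  V = Vector ℝ (rank X)

  value : Φ₊ → V → ℝ
  value α = linearForm (root α)

  InDominantChamber : V → Set
  InDominantChamber x = ∀ α → 0ℝ < value α x

  OffShiArrangement : V → Set
  OffShiArrangement x = ∀ α → value α x # 0ℝ × value α x # 1ℝ

  -- The union of the dominant regions: a component of the complement of
  -- the arrangement lies either inside or outside of the dominant chamber.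
  record DominantPoint : Set₁ where
    constructor point
    field
      position : V
      dominant : InDominantChamber position
      offShi   : OffShiArrangement position

  open DominantPoint

  -- The region corresponding to the antichain p.
  InRegion : Subset #Φ₊ → V → Set
  InRegion p x = ∀ α → (InIdeal p α → 1ℝ < value α x)
                     × (¬ InIdeal p α → 0ℝ < value α x × value α x < 1ℝ)

  1<value? : ∀ (x : DominantPoint) α → Dec (1ℝ < value α (position x))
  1<value? x α with proj₂ (offShi x α)
  ... | inj₁ α<1 = no (<-asym {value α (position x)} {1ℝ} α<1)
  ... | inj₂ 1<α = yes 1<α

  inRegion? : ∀ p (x : DominantPoint) → Dec (InRegion p (position x))
  inRegion? p x = Fin.all? λ α →
    (inIdeal? p α →-dec 1<value? x α) ×-dec
    (¬? (inIdeal? p α) →-dec map′ (λ α<1 → dominant x α , α<1) proj₂ (value<1? α))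
    where
    value<1? : ∀ α → Dec (value α (position x) < 1ℝ)
    value<1? α with proj₂ (offShi x α)
    ... | inj₁ α<1 = yes α<1
    ... | inj₂ 1<α = no (<-asym {1ℝ} {value α (position x)} 1<α)

  ----------------------------------------------------------------------
  -- The ring of locally constant functions.  Local constancy forces fun
  -- to respect equality of real numbers (points with the same cuts lie in
  -- the same boxes) and not to depend on the proofs in a DominantPoint.

  record LocallyConstant : Set₁ where
    field
      fun           : DominantPoint → ℤ
      locally-const : ∀ x → ∃ λ I → position x ∈ᵇ I ×
                        (∀ y → position y ∈ᵇ I → fun y ≡ fun x)

  open LocallyConstant

  private
    fromNear : (f : DominantPoint → ℤ) →
               (∀ x → Near (position x) (λ v → ∀ d o → f (point v d o) ≡ f x)) → LocallyConstant
    fromNear f nearby = record { fun = f ; locally-const = λ x →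
      let near I x∈I eq = nearby x in I , x∈I , λ y y∈I → eq (position y) y∈I (dominant y) (offShi y) }

    toNear : ∀ f x → Near (position x) (λ v → ∀ d o → fun f (point v d o) ≡ fun f x)
    toNear f x = let I , x∈I , eq = locally-const f x in
      near I x∈I λ v v∈I d o → eq (point v d o) v∈I

    constant : ℤ → LocallyConstant
    constant c = fromNear (λ _ → c) (λ x → near-all (λ _ _ _ → refl))

    lift₁ : (ℤ → ℤ) → LocallyConstant → LocallyConstant
    lift₁ _*_ f = fromNear (λ x → _*_ (fun f x))
      (λ x → near-map (λ _ eq d o → cong _*_ (eq d o)) (toNear f x))

    lift₂ : (ℤ → ℤ → ℤ) → LocallyConstant → LocallyConstant → LocallyConstant
    lift₂ _*_ f g = fromNear (λ x → fun f x * fun g x)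
      (λ x → near-map (λ { _ (eq₁ , eq₂) d o → cong₂ _*_ (eq₁ d o) (eq₂ d o) })
                      (near-× (toNear f x) (toNear g x)))

    H-rawRing : RawRing (lsuc 0ℓ) (lsuc 0ℓ)
    H-rawRing = record
      { Carrier = LocallyConstant
      ; _≈_     = λ f g → ∀ x → fun f x ≡ fun g x
      ; _+_     = lift₂ ℤ._+_
      ; _*_     = lift₂ ℤ._*_
      ; -_      = lift₁ (λ a → ℤ.- a)
      ; 0#      = constant 0ℤ
      ; 1#      = constant 1ℤ
      }

    fun-isRingMonomorphism : IsRingMonomorphism H-rawRing
      (CommutativeRing.rawRing (Pointwise.commutativeRing DominantPoint ℤ.+-*-commutativeRing)) fun
    fun-isRingMonomorphism = record
      { isRingHomomorphism = record
        { isSemiringHomomorphism = record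
          { isNearSemiringHomomorphism = record
            { +-isMonoidHomomorphism = record
              { isMagmaHomomorphism = record
                { isRelHomomorphism = record { cong = λ eq → eq }
                ; homo = λ _ _ _ → refl
                }
              ; ε-homo = λ _ → refl
              }
            ; *-homo = λ _ _ _ → refl
            }
          ; 1#-homo = λ _ → refl
          }
        ; -‿homo = λ _ _ → refl
        }
      ; injective = λ eq → eq
      }

  H : CommutativeRing (lsuc 0ℓ) (lsuc 0ℓ)
  H = record
    { RawRing H-rawRing
    ; isCommutativeRing = RingMonomorphism.isCommutativeRing fun-isRingMonomorphism
        (CommutativeRing.isCommutativeRing
          (Pointwise.commutativeRing DominantPoint ℤ.+-*-commutativeRing))
    }

  private
    -- Near a point, every positive root stays on the same side of 1.
    SameSides : DominantPoint → V → Set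
    SameSides x v = ∀ α → (value α (position x) < 1ℝ × value α v < 1ℝ)
                        ⊎ (1ℝ < value α (position x) × 1ℝ < value α v)

    near-sameSides : ∀ x → Near (position x) (SameSides x)
    near-sameSides x = near-∀ near-α
      where
      near-α : ∀ α → Near (position x) (λ v → (value α (position x) < 1ℝ × value α v < 1ℝ)
                                           ⊎ (1ℝ < value α (position x) × 1ℝ < value α v))
      near-α α with proj₂ (offShi x α)
      ... | inj₁ α<1 = near-map (λ _ lt → inj₁ (α<1 , lt))
                         (near-< {F = value α} {r = 1ℝ} (cont-linearForm (root α)) α<1)
      ... | inj₂ 1<α = near-map (λ _ gt → inj₂ (1<α , gt))
                         (near-> {F = value α} {r = 1ℝ} (cont-linearForm (root α)) 1<α)

  h-root : Φ₊ → LocallyConstant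
  h-root α = fromNear h λ x → near-map (λ v same d o → agree x (point v d o) (same α)) (near-sameSides x)
    where
    h : DominantPoint → ℤ
    h x = if does (1<value? x α) then 1ℤ else 0ℤ

    agree : ∀ x y → (value α (position x) < 1ℝ × value α (position y) < 1ℝ)
                  ⊎ (1ℝ < value α (position x) × 1ℝ < value α (position y)) → h y ≡ h x
    agree x y same = cong (λ b → if b then 1ℤ else 0ℤ)
      (does-⇔ (mk⇔ (toX same) (toY same)) (1<value? y α) (1<value? x α))
      where
      toX : _ → 1ℝ < value α (position y) → 1ℝ < value α (position x)
      toX (inj₁ (_ , <y)) >y = ⊥-elim (<-asym {1ℝ} {value α (position y)} >y <y)
      toX (inj₂ (>x , _)) _  = >x
      toY : _ → 1ℝ < value α (position x) → 1ℝ < value α (position y)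
      toY (inj₁ (<x , _)) >x = ⊥-elim (<-asym {1ℝ} {value α (position x)} >x <x)
      toY (inj₂ (_ , >y)) _  = >y

  h : Subset #Φ₊ → LocallyConstant
  h p = List.foldr _*_ 1# (List.map h-root (List.filter (_∈? p) (List.allFin #Φ₊)))
    where open CommutativeRing H using (_*_; 1#)

  δ : Subset #Φ₊ → LocallyConstant
  δ p = fromNear indicator λ x → near-map (λ v same d o → agree x (point v d o) same) (near-sameSides x)
    where
    indicator : DominantPoint → ℤ
    indicator x = if does (inRegion? p x) then 1ℤ else 0ℤ

    transport : ∀ x y → SameSides x (position y) →
                InRegion p (position x) → InRegion p (position y)
    transport x y same r α with same α
    ... | inj₁ (<x , <y) =
      (λ i → ⊥-elim (<-asym {value α (position x)} {1ℝ} <x (proj₁ (r α) i))) , λ _ → dominant y α , <y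
    ... | inj₂ (>x , >y) =
      (λ _ → >y) , λ i → ⊥-elim (<-asym {1ℝ} {value α (position x)} >x (proj₂ (proj₂ (r α) i)))

    swap : ∀ x y → SameSides x (position y) → SameSides y (position x)
    swap x y same α with same α
    ... | inj₁ (<x , <y) = inj₁ (<y , <x)
    ... | inj₂ (>x , >y) = inj₂ (>y , >x)

    agree : ∀ x y → SameSides x (position y) → indicator y ≡ indicator x
    agree x y same = cong (λ b → if b then 1ℤ else 0ℤ)
      (does-⇔ (mk⇔ (transport y x (swap x y same)) (transport x y same))
              (inRegion? p y) (inRegion? p x))

  ∑δ : List (Subset #Φ₊) → LocallyConstant
  ∑δ qs = List.foldr _+ᴴ_ 0# (List.map δ qs)
    where open CommutativeRing H using (0#) renaming (_+_ to _+ᴴ_)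

{-# OPTIONS --safe #-}

-- The set S of positive roots α with α(x) > 1 at a dominant point x is an
-- upper ideal, since all coordinates of x are positive.  Hence x lies in the
-- region of exactly one antichain, the set m of minimal elements of S, and
-- I_m = S.  So the value at x of either side is 1 or 0 according to whether
-- p ⊆ S, which is the same as p ≼ m.
module Submission where

open import Defs
open import Algebra.Bundles using (CommutativeRing)
open import Data.Fin.Subset using (Subset)

import Data.Rational.Properties as ℚ
open import Algebra.Properties.Group ℚ.+-0-group using (⁻¹-involutive)
open import Data.Bool.Base using (Bool; true; false; if_then_else_)
open import Data.Fin.Base using (Fin; zero; suc)
open import Data.Fin.Induction using (po-wellFounded)
import Data.Fin.Properties as Fin
open import Data.Fin.Subset using (inside; outside; _∈_)
open import Data.Fin.Subset.Properties using (_∈?_; ⊆-antisym)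
open import Data.Integer.Base as ℤ using (ℤ; 0ℤ; 1ℤ; +_; -[1+_])
import Data.Integer.Properties as ℤ
open import Data.List.Base as List using (List; []; _∷_)
import Data.List.Membership.Propositional as List
open import Data.List.Membership.Propositional.Properties
  using (∈-allFin; ∈-cartesianProductWith⁺; ∈-filter⁺; ∈-filter⁻; ∈-lookup)
open import Data.List.Relation.Unary.All as ListAll using ([]; _∷_)
import Data.List.Relation.Unary.All.Properties as ListAll
open import Data.List.Relation.Unary.AllPairs using ([]; _∷_)
open import Data.List.Relation.Unary.Any using (here; there; index)
open import Data.List.Relation.Unary.Any.Properties using (lookup-index)
open import Data.List.Relation.Unary.Unique.Propositional using (Unique)
import Data.List.Relation.Unary.Unique.Propositional.Properties as Unique
open import Data.Nat.Base as ℕ using (zero; suc; z≤n; s≤s)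
open import Data.Product.Base using (∃; _×_; _,_; proj₁; proj₂)
open import Data.Rational.Base as ℚ using (0ℚ)
open import Data.Sum.Base using (inj₁; inj₂)
open import Data.Vec.Base as Vec using (Vec)
open import Data.Vec.Functional as Vector using (Vector)
import Data.Vec.Properties as Vec
open import Data.Vec.Relation.Binary.Pointwise.Extensional using (ext; Pointwise-≡⇒≡)
open import Data.Vec.Relation.Unary.All.Properties using (lookup⁺; lookup⁻)
open import Function.Base using (_∘_)
open import Induction.WellFounded using (Acc; acc)
open import Relation.Binary.Definitions using (Decidable)
open import Relation.Binary.PropositionalEquality
  using (_≡_; _≢_; refl; sym; trans; cong; cong₂; subst; isEquivalence)
open import Relation.Binary.Structures using (IsPartialOrder)
open import Relation.Nullary using (¬_; Dec; yes; no; does; contradiction)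
open import Relation.Nullary.Decidable using (_×-dec_; _→-dec_; ¬?; dec-true; dec-false; decidable-stable)
open import Relation.Unary as Pred using (Pred)

open ℝ

-- Order on the reals and its monotonicity laws.

infix 4 _≤_

-- Lower cuts alone suffice, since `≤⇒U-⊇` recovers the upper ones. Below, sums and multiples are
-- only ever compared by this order, so no equality of reals enters.
_≤_ : ℝ → ℝ → Set
x ≤ y = L x Pred.⊆ L y

<-≤-trans : ∀ x y z → x < y → y ≤ z → x < z
<-≤-trans x y z (q , Ux , Ly) y≤z = q , Ux , y≤z Ly

-- Lower the bound `q` to some `p < q` still above `y`. As `x` is located between `p` and `q`,
-- either `q` is above `x`, or `p` is below `x` and so in both cuts of `y`.
≤⇒U-⊇ : ∀ x y → x ≤ y → U y Pred.⊆ U x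
≤⇒U-⊇ x y x≤y Uq with U-open y Uq
... | p , p<q , Up with located x p<q
...   | inj₁ Lp = contradiction (x≤y Lp , Up) (disjoint y)
...   | inj₂ Uq = Uq

+-mono-≤ : ∀ x y z w → x ≤ y → z ≤ w → x + z ≤ y + w
+-mono-≤ x y z w x≤y z≤w (a , b , La , Lb , lt) = a , b , x≤y La , z≤w Lb , lt

x+y≤x : ∀ x y → y ≤ 0ℝ → x + y ≤ x
x+y≤x x y y≤0 (a , b , La , Lb , q<a+b) =
  L-lower x (ℚ.<-trans q<a+b (subst (a ℚ.+ b ℚ.<_) (ℚ.+-identityʳ a)
                                    (ℚ.+-monoʳ-< a (y≤0 Lb)))) La

x+y≤y : ∀ x y → x ≤ 0ℝ → x + y ≤ y
x+y≤y x y x≤0 (a , b , La , Lb , q<a+b) =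
  L-lower y (ℚ.<-trans q<a+b (subst (a ℚ.+ b ℚ.<_) (ℚ.+-identityˡ b)
                                    (ℚ.+-monoˡ-< b (x≤0 La)))) Lb

y≤x+y : ∀ x y → 0ℝ < x → y ≤ x + y
y≤x+y x y (e , 0<e , Le) {q} Lq =
  e , q , Le , Lq , subst (ℚ._< e ℚ.+ q) (ℚ.+-identityˡ q) (ℚ.+-monoˡ-< q 0<e)

·ℕ-monoˡ-≤ : ∀ x {k l} → 0ℝ < x → k ℕ.≤ l → k ·ℕ x ≤ l ·ℕ x
·ℕ-monoˡ-≤ x {l = zero}  0<x z≤n q<0 = q<0
·ℕ-monoˡ-≤ x {l = suc l} 0<x z≤n q<0 = y≤x+y x (l ·ℕ x) 0<x (·ℕ-monoˡ-≤ x {0} {l} 0<x z≤n q<0)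
·ℕ-monoˡ-≤ x {suc k} {suc l} 0<x (s≤s k≤l) =
  +-mono-≤ x x (k ·ℕ x) (l ·ℕ x) (λ Lq → Lq) (·ℕ-monoˡ-≤ x {k} {l} 0<x k≤l)

-- Negation swaps the two cuts, so negative multiples are compared through upper cuts of natural
-- multiples.
·-monoˡ-≤ : ∀ x {a b} → 0ℝ < x → a ℤ.≤ b → a · x ≤ b · x
·-monoˡ-≤ x { + k } { + l } 0<x (ℤ.+≤+ k≤l) = ·ℕ-monoˡ-≤ x {k} {l} 0<x k≤l
·-monoˡ-≤ x { -[1+ k ] } { -[1+ l ] } 0<x (ℤ.-≤- l≤k) =
  ≤⇒U-⊇ (suc l ·ℕ x) (suc k ·ℕ x) (·ℕ-monoˡ-≤ x {suc l} {suc k} 0<x (s≤s l≤k))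
-- The comparison passes through 0: `U-q` puts `- q` in the upper cut of a natural multiple of `x`,
-- hence in that of `0ℝ`, so `q` is negative.
·-monoˡ-≤ x { -[1+ k ] } { + l } 0<x ℤ.-≤+ {q} U-q =
  ·ℕ-monoˡ-≤ x {0} {l} 0<x z≤n (subst (ℚ._< 0ℚ) (⁻¹-involutive q) (ℚ.neg-antimono-< 0<-q))
  where
  0<-q : 0ℚ ℚ.< ℚ.- q
  0<-q = ≤⇒U-⊇ 0ℝ (suc k ·ℕ x) (·ℕ-monoˡ-≤ x {0} {suc k} 0<x z≤n) U-q

-- Sums and linear forms.

∑ : ∀ {n} → Vector ℝ n → ℝ
∑ = Vector.foldr _+_ 0ℝ

∑-mono-≤ : ∀ {n} (f g : Vector ℝ n) → (∀ i → f i ≤ g i) → ∑ f ≤ ∑ g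
∑-mono-≤ {zero}  f g f≤g q<0 = q<0
∑-mono-≤ {suc n} f g f≤g =
  +-mono-≤ (f zero) (g zero) (∑ (f ∘ suc)) (∑ (g ∘ suc))
    (f≤g zero) (∑-mono-≤ (f ∘ suc) (g ∘ suc) (f≤g ∘ suc))

∑-nonPositive : ∀ {n} (f : Vector ℝ n) → (∀ i → f i ≤ 0ℝ) → ∑ f ≤ 0ℝ
∑-nonPositive {zero}  f f≤0 q<0 = q<0
∑-nonPositive {suc n} f f≤0 Lq = f≤0 zero
  (x+y≤x (f zero) (∑ (f ∘ suc)) (∑-nonPositive (f ∘ suc) (f≤0 ∘ suc)) Lq)

∑-≤-term : ∀ {n} (f : Vector ℝ n) i → (∀ j → i ≢ j → f j ≤ 0ℝ) → ∑ f ≤ f i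
∑-≤-term f zero    f≤0 = x+y≤x (f zero) (∑ (f ∘ suc))
  (∑-nonPositive (f ∘ suc) λ j → f≤0 (suc j) λ ())
∑-≤-term f (suc i) f≤0 Lq =
  ∑-≤-term (f ∘ suc) i (λ j i≢j → f≤0 (suc j) (i≢j ∘ Fin.suc-injective))
    (x+y≤y (f zero) (∑ (f ∘ suc)) (f≤0 zero λ ()) Lq)

linearForm-mono-≤ : ∀ {n} (α β : Vec ℤ n) x → (∀ i → 0ℝ < x i) →
                    (∀ i → Vec.lookup α i ℤ.≤ Vec.lookup β i) →
                    linearForm α x ≤ linearForm β x
linearForm-mono-≤ α β x 0<x α≤β =
  ∑-mono-≤ (λ i → Vec.lookup α i · x i) (λ i → Vec.lookup β i · x i)
    λ i → ·-monoˡ-≤ (x i) (0<x i) (α≤β i)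

-- Off the diagonal the terms compute to `0ℝ`, and the diagonal term to `x i + 0ℝ`. This direction
-- is the one that carries positivity from the simple root to the coordinate.
linearForm-simple-≤ : ∀ {n} (i : Fin n) x → linearForm (simple i) x ≤ x i
linearForm-simple-≤ i x Lq =
  diagonal (∑-≤-term (λ j → Vec.lookup (simple i) j · x j) i off-diagonal Lq)
  where
  coefficient : ∀ j → Vec.lookup (simple i) j ≡ (if does (i Fin.≟ j) then 1ℤ else 0ℤ)
  coefficient = Vec.lookup∘tabulate _

  off-diagonal : ∀ j → i ≢ j → Vec.lookup (simple i) j · x j ≤ 0ℝ
  off-diagonal j i≢j rewrite coefficient j | dec-false (i Fin.≟ j) i≢j = λ q<0 → q<0

  diagonal : Vec.lookup (simple i) i · x i ≤ x i
  diagonal rewrite coefficient i | dec-true (i Fin.≟ i) refl = x+y≤x (x i) 0ℝ λ q<0 → q<0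

-- Lists without repetitions, finite subsets and their enumeration.

lookup-injective : ∀ {a} {A : Set a} {xs : List A} → Unique xs →
                   ∀ i j → List.lookup xs i ≡ List.lookup xs j → i ≡ j
lookup-injective (_  ∷ _)   zero    zero    _  = refl
lookup-injective (px ∷ _)   zero    (suc j) eq = contradiction eq (ListAll.lookup px (∈-lookup j))
lookup-injective (px ∷ _)   (suc i) zero    eq = contradiction (sym eq) (ListAll.lookup px (∈-lookup i))
lookup-injective (_  ∷ pxs) (suc i) (suc j) eq = cong suc (lookup-injective pxs i j eq)

module _ {n ℓ} {P : Pred (Fin n) ℓ} (P? : Pred.Decidable P) where

  comprehension : Subset n
  comprehension = Vec.tabulate (does ∘ P?)

  ∈-comprehension⁺ : ∀ {i} → P i → i ∈ comprehension
  ∈-comprehension⁺ {i} Pi = Vec.lookup⇒[]= i comprehension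
    (trans (Vec.lookup∘tabulate _ i) (dec-true (P? i) Pi))

  ∈-comprehension⁻ : ∀ {i} → i ∈ comprehension → P i
  ∈-comprehension⁻ {i} i∈ with P? i | trans (sym (Vec.lookup∘tabulate _ i)) (Vec.[]=⇒lookup i∈)
  ... | yes Pi | _  = Pi
  ... | no  _  | ()

∈-subsets : ∀ {n} (p : Subset n) → p List.∈ subsets n
∈-subsets Vec.[]            = here refl
∈-subsets (outside Vec.∷ p) = ∈-cartesianProductWith⁺ Vec._∷_ {xs = outside ∷ inside ∷ []}
  (here refl) (∈-subsets p)
∈-subsets (inside  Vec.∷ p) = ∈-cartesianProductWith⁺ Vec._∷_ {xs = outside ∷ inside ∷ []}
  (there (here refl)) (∈-subsets p)

subsets-unique : ∀ n → Unique (subsets n)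
subsets-unique zero    = [] ∷ []
subsets-unique (suc n) = Unique.cartesianProductWith⁺ Vec._∷_ Vec.∷-injective
  (((λ ()) ∷ []) ∷ [] ∷ []) (subsets-unique n)

-- Minimal elements in a finite partial order.

module Minimal {n ℓ₁ ℓ₂} {_⊑_ : Fin n → Fin n → Set ℓ₁} (isPO : IsPartialOrder _≡_ _⊑_)
               (_⊑?_ : Decidable _⊑_) {P : Pred (Fin n) ℓ₂} (P? : Pred.Decidable P) where

  open IsPartialOrder isPO using () renaming (refl to ⊑-refl; trans to ⊑-trans)

  IsMinimal : Pred (Fin n) _
  IsMinimal i = P i × (∀ j → P j → j ⊑ i → j ≡ i)

  isMinimal? : Pred.Decidable IsMinimal
  isMinimal? i = P? i ×-dec Fin.all? λ j → P? j →-dec (j ⊑? i →-dec j Fin.≟ i)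

  -- The strict part of a partial order on a finite set is well-founded, so a descent within `P`
  -- from `i` must stop. Each step is a decidable search for a strictly smaller element of `P`.
  minimalBelow : ∀ {i} → P i → ∃ λ m → IsMinimal m × m ⊑ i
  minimalBelow {i} = descend (po-wellFounded isPO i)
    where
    descend : ∀ {i} → Acc _ i → P i → ∃ λ m → IsMinimal m × m ⊑ i
    descend {i} (acc rec) Pi
      with Fin.any? (λ j → P? j ×-dec (j ⊑? i ×-dec ¬? (j Fin.≟ i)))
    ... | yes (j , Pj , j⊑i , j≢i) = let m , min , m⊑j = descend (rec (j⊑i , j≢i)) Pj
                                      in m , min , ⊑-trans m⊑j j⊑i
    ... | no ∄j = i , (Pi , minimal) , ⊑-refl
      where
      minimal : ∀ j → P j → j ⊑ i → j ≡ i
      minimal j Pj j⊑i with j Fin.≟ i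
      ... | yes j≡i = j≡i
      ... | no  j≢i = contradiction (j , Pj , j⊑i , j≢i) ∄j

⟦_⟧ : Bool → ℤ
⟦ b ⟧ = if b then 1ℤ else 0ℤ

-- The poset of positive roots and the antichains above `p`.

module _ {X : DynkinType} (R : RootSystem X) where

  open RootSystem R
  open DominantPoint
  open LocallyConstant

  RootLe⇒≤ : ∀ {α β} → RootLe R α β → ∀ i → Vec.lookup (root R α) i ℤ.≤ Vec.lookup (root R β) i
  RootLe⇒≤ {α} {β} α≤β i = ℤ.0≤i-j⇒j≤i
    (subst (0ℤ ℤ.≤_) (Vec.lookup-zipWith ℤ._-_ i (root R β) (root R α)) (lookup⁺ α≤β i))

  ≤⇒RootLe : ∀ {α β} → (∀ i → Vec.lookup (root R α) i ℤ.≤ Vec.lookup (root R β) i) → RootLe R α β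
  ≤⇒RootLe {α} {β} α≤β = lookup⁻ λ i →
    subst (0ℤ ℤ.≤_) (sym (Vec.lookup-zipWith ℤ._-_ i (root R β) (root R α))) (ℤ.i≤j⇒0≤j-i (α≤β i))

  -- Positive roots are positions in a list, so antisymmetry of `RootLe` needs that no root is
  -- listed twice; filtering preserves this.
  root-injective : ∀ {α β} → root R α ≡ root R β → α ≡ β
  root-injective = lookup-injective (Unique.filter⁺ nonNegative? unique) _ _

  RootLe-isPartialOrder : IsPartialOrder _≡_ (RootLe R)
  RootLe-isPartialOrder = record
    { isPreorder = record
      { isEquivalence = isEquivalence
      ; reflexive     = λ { refl → ≤⇒RootLe λ i → ℤ.≤-refl }
      ; trans         = λ α≤β β≤γ → ≤⇒RootLe λ i → ℤ.≤-trans (RootLe⇒≤ α≤β i) (RootLe⇒≤ β≤γ i)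
      }
    ; antisym = λ α≤β β≤α → root-injective
        (Pointwise-≡⇒≡ (ext λ i → ℤ.≤-antisym (RootLe⇒≤ α≤β i) (RootLe⇒≤ β≤α i)))
    }

  open IsPartialOrder RootLe-isPartialOrder using ()
    renaming (refl to RootLe-refl; trans to RootLe-trans; antisym to RootLe-antisym)

  simple-nonNegative : ∀ i → NonNegative (simple {rank X} i)
  simple-nonNegative i = lookup⁻ λ j → subst (0ℤ ℤ.≤_) (sym (Vec.lookup∘tabulate _ j))
    (indicator-nonNegative (does (i Fin.≟ j)))
    where
    indicator-nonNegative : ∀ b → 0ℤ ℤ.≤ ⟦ b ⟧
    indicator-nonNegative false = ℤ.+≤+ z≤n
    indicator-nonNegative true  = ℤ.+≤+ z≤n

  -- Simple roots are positive roots, and the coordinates of `x` are their values.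
  dominant⇒positive : ∀ {x} → InDominantChamber R x → ∀ i → 0ℝ < x i
  dominant⇒positive {x} 0<x i = <-≤-trans 0ℝ (linearForm (simple i) x) (x i)
    (subst (λ α → 0ℝ < linearForm α x) (sym (lookup-index simple∈Φ₊)) (0<x (index simple∈Φ₊)))
    (linearForm-simple-≤ i x)
    where
    simple∈Φ₊ : simple i List.∈ positiveRoots R
    simple∈Φ₊ = ∈-filter⁺ nonNegative? (simple∈ i) (simple-nonNegative i)

  isAntichainAbove? : ∀ p q → Dec (IsAntichain R q × Precedes R p q)
  isAntichainAbove? p q = isAntichain? R q ×-dec precedes? R p q

  antichainsAbove-areAntichains : ∀ p → ListAll.All (IsAntichain R) (antichainsAbove R p)
  antichainsAbove-areAntichains p =
    ListAll.map proj₁ (ListAll.all-filter (isAntichainAbove? p) (subsets (#Φ₊ R)))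

  -- Ensures that the one antichain whose region contains a given point contributes only once to the
  -- sum.
  antichainsAbove-unique : ∀ p → Unique (antichainsAbove R p)
  antichainsAbove-unique p = Unique.filter⁺ (isAntichainAbove? p) (subsets-unique (#Φ₊ R))

  ∈-antichainsAbove⁺ : ∀ {p q} → IsAntichain R q → Precedes R p q → q List.∈ antichainsAbove R p
  ∈-antichainsAbove⁺ {p} {q} anti p≼q = ∈-filter⁺ (isAntichainAbove? p) (∈-subsets q) (anti , p≼q)

  ∈-antichainsAbove⁻ : ∀ {p q} → q List.∈ antichainsAbove R p → Precedes R p q
  ∈-antichainsAbove⁻ {p} q∈ = proj₂ (proj₂ (∈-filter⁻ (isAntichainAbove? p) {xs = subsets (#Φ₊ R)} q∈))

  -- The antichain of a dominant point: `Large` is S and `minimalLarge` is m.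

  module _ (x : DominantPoint R) where

    Large : Φ₊ R → Set
    Large α = 1ℝ < value R α (position x)

    large? : ∀ α → Dec (Large α)
    large? = 1<value? R x

    Large-upper : ∀ {α β} → RootLe R α β → Large α → Large β
    Large-upper {α} {β} α≤β 1<α =
      <-≤-trans 1ℝ (value R α (position x)) (value R β (position x)) 1<α
        (linearForm-mono-≤ (root R α) (root R β) (position x)
          (dominant⇒positive {position x} (dominant x)) (RootLe⇒≤ α≤β))

    ¬Large⇒<1 : ∀ {α} → ¬ Large α → value R α (position x) < 1ℝ
    ¬Large⇒<1 {α} 1≮α with proj₂ (offShi x α)
    ... | inj₁ α<1 = α<1
    ... | inj₂ 1<α = contradiction 1<α 1≮α

    open Minimal RootLe-isPartialOrder (rootLe? R) large?

    minimalLarge : Subset (#Φ₊ R)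
    minimalLarge = comprehension isMinimal?

    minimalLarge-isAntichain : IsAntichain R minimalLarge
    minimalLarge-isAntichain α β α∈m β∈m α≢β α≤β =
      α≢β (proj₂ (∈-comprehension⁻ isMinimal? β∈m) α (proj₁ (∈-comprehension⁻ isMinimal? α∈m)) α≤β)

    Large⇒InIdeal : ∀ {α} → Large α → InIdeal R minimalLarge α
    Large⇒InIdeal α> = let μ , min , μ≤α = minimalBelow α>
                       in μ , ∈-comprehension⁺ isMinimal? min , μ≤α

    InIdeal⇒Large : ∀ {α} → InIdeal R minimalLarge α → Large α
    InIdeal⇒Large (μ , μ∈m , μ≤α) = Large-upper μ≤α (proj₁ (∈-comprehension⁻ isMinimal? μ∈m))

    inRegion-minimalLarge : InRegion R minimalLarge (position x)
    inRegion-minimalLarge α = InIdeal⇒Large , λ α∉I → dominant x α , ¬Large⇒<1 (α∉I ∘ Large⇒InIdeal)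

    -- If `x` is in the region of `q`, the ideal generated by `q` is S, and an antichain consists of
    -- the minimal elements of the ideal it generates.
    inRegion⇒≡minimalLarge : ∀ {q} → IsAntichain R q → InRegion R q (position x) → q ≡ minimalLarge
    inRegion⇒≡minimalLarge {q} anti x∈q = ⊆-antisym q⊆m m⊆q
      where
      Large⇒InIdeal-q : ∀ α → Large α → InIdeal R q α
      Large⇒InIdeal-q α 1<α with inIdeal? R q α
      ... | yes α∈I = α∈I
      ... | no  α∉I = contradiction (proj₂ (proj₂ (x∈q α) α∉I)) (<-asym {1ℝ} {value R α (position x)} 1<α)

      ∈⇒Large : ∀ {α} → α ∈ q → Large α
      ∈⇒Large {α} α∈q = proj₁ (x∈q α) (α , α∈q , RootLe-refl)

      q⊆m : ∀ {α} → α ∈ q → α ∈ minimalLarge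
      q⊆m {α} α∈q = ∈-comprehension⁺ isMinimal? (∈⇒Large α∈q , minimal)
        where
        minimal : ∀ β → Large β → RootLe R β α → β ≡ α
        -- Some `γ` in `q` lies below `β`. Then `γ ≤ β ≤ α` with both ends in the antichain forces
        -- `γ ≡ α`, and `β` is squeezed between.
        minimal β 1<β β≤α with Large⇒InIdeal-q β 1<β
        ... | γ , γ∈q , γ≤β with γ Fin.≟ α
        ...   | yes refl = RootLe-antisym β≤α γ≤β
        ...   | no  γ≢α  = contradiction (RootLe-trans γ≤β β≤α) (anti γ α γ∈q α∈q γ≢α)

      m⊆q : ∀ {α} → α ∈ minimalLarge → α ∈ q
      m⊆q {α} α∈m with ∈-comprehension⁻ isMinimal? α∈m
      -- The element `γ` of `q` below `α` is itself large, so minimality of `α` identifies the two.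
      ... | 1<α , minimal with Large⇒InIdeal-q α 1<α
      ...   | γ , γ∈q , γ≤α = subst (_∈ q) (minimal γ (∈⇒Large γ∈q) γ≤α) γ∈q

    -- Values at `x` of sums of `δ` and products of `h-root`.

    δ-minimalLarge : fun (δ R minimalLarge) x ≡ 1ℤ
    δ-minimalLarge = cong ⟦_⟧ (dec-true (inRegion? R minimalLarge x) inRegion-minimalLarge)

    δ-≢minimalLarge : ∀ {q} → IsAntichain R q → q ≢ minimalLarge → fun (δ R q) x ≡ 0ℤ
    δ-≢minimalLarge {q} anti q≢m =
      cong ⟦_⟧ (dec-false (inRegion? R q x) (q≢m ∘ inRegion⇒≡minimalLarge anti))

    ∑δ-∌minimalLarge : ∀ qs → ListAll.All (IsAntichain R) qs → ¬ minimalLarge List.∈ qs →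
                       fun (∑δ R qs) x ≡ 0ℤ
    ∑δ-∌minimalLarge []       []          m∉ = refl
    ∑δ-∌minimalLarge (q ∷ qs) (anti ∷ as) m∉ =
      cong₂ ℤ._+_ (δ-≢minimalLarge anti (m∉ ∘ here ∘ sym)) (∑δ-∌minimalLarge qs as (m∉ ∘ there))

    -- Only the term of `minimalLarge` is nonzero. Once it is met at the head, uniqueness keeps it
    -- out of the tail, which sums to 0.
    ∑δ-∋minimalLarge : ∀ qs → ListAll.All (IsAntichain R) qs → Unique qs → minimalLarge List.∈ qs →
                       fun (∑δ R qs) x ≡ 1ℤ
    ∑δ-∋minimalLarge (q ∷ qs) (_    ∷ as) (q∉ ∷ _)  (here refl) =
      cong₂ ℤ._+_ δ-minimalLarge (∑δ-∌minimalLarge qs as λ m∈ → ListAll.lookup q∉ m∈ refl)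
    ∑δ-∋minimalLarge (q ∷ qs) (anti ∷ as) (q∉ ∷ us) (there m∈)  =
      cong₂ ℤ._+_ (δ-≢minimalLarge anti (ListAll.lookup q∉ m∈)) (∑δ-∋minimalLarge qs as us m∈)

    -- `h R p` unfolds to this product over `elements p`; an arbitrary list allows induction.
    ∏h : List (Φ₊ R) → LocallyConstant R
    ∏h αs = List.foldr _*_ 1# (List.map (h-root R) αs)
      where open CommutativeRing (H R) using (_*_; 1#)

    h-root-large : ∀ {α} → Large α → fun (h-root R α) x ≡ 1ℤ
    h-root-large {α} 1<α = cong ⟦_⟧ (dec-true (large? α) 1<α)

    h-root-small : ∀ {α} → ¬ Large α → fun (h-root R α) x ≡ 0ℤ
    h-root-small {α} 1≮α = cong ⟦_⟧ (dec-false (large? α) 1≮α)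

    ∏h-large : ∀ αs → ListAll.All Large αs → fun (∏h αs) x ≡ 1ℤ
    ∏h-large []       []           = refl
    ∏h-large (α ∷ αs) (1<α ∷ 1<αs) = cong₂ ℤ._*_ (h-root-large 1<α) (∏h-large αs 1<αs)

    ∏h-small : ∀ {α} αs → α List.∈ αs → ¬ Large α → fun (∏h αs) x ≡ 0ℤ
    ∏h-small (α ∷ αs) (here refl) 1≮α = cong (ℤ._* fun (∏h αs) x) (h-root-small 1≮α)
    ∏h-small (β ∷ αs) (there α∈)  1≮α =
      trans (cong (fun (h-root R β) x ℤ.*_) (∏h-small αs α∈ 1≮α)) (ℤ.*-zeroʳ (fun (h-root R β) x))

    -- Both sides at `x`, according to whether `p` is contained in S.

    module _ (p : Subset (#Φ₊ R)) where

      elements : List (Φ₊ R)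
      elements = List.filter (_∈? p) (List.allFin (#Φ₊ R))

      h-large : (∀ {α} → α ∈ p → Large α) → fun (h R p) x ≡ 1ℤ
      h-large p-large =
        ∏h-large elements (ListAll.map p-large (ListAll.all-filter (_∈? p) (List.allFin (#Φ₊ R))))

      h-small : ∀ {α} → α ∈ p → ¬ Large α → fun (h R p) x ≡ 0ℤ
      h-small {α} α∈p = ∏h-small elements (∈-filter⁺ (_∈? p) (∈-allFin α) α∈p)

      -- S is an upper ideal containing `p`, so it contains the ideal of `p`; as S is the ideal of
      -- `minimalLarge`, that antichain is among the summands.
      ∑δ-large : (∀ {α} → α ∈ p → Large α) → fun (∑δ R (antichainsAbove R p)) x ≡ 1ℤ
      ∑δ-large p-large = ∑δ-∋minimalLarge (antichainsAbove R p)
        (antichainsAbove-areAntichains p) (antichainsAbove-unique p)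
        (∈-antichainsAbove⁺ minimalLarge-isAntichain p≼m)
        where
        p≼m : Precedes R p minimalLarge
        p≼m β (α , α∈p , α≤β) = Large⇒InIdeal (Large-upper α≤β (p-large α∈p))

      -- Were `minimalLarge` a summand, the element `α` of `p` would lie in its ideal, which is S.
      ∑δ-small : ∀ {α} → α ∈ p → ¬ Large α → fun (∑δ R (antichainsAbove R p)) x ≡ 0ℤ
      ∑δ-small {α} α∈p 1≮α = ∑δ-∌minimalLarge (antichainsAbove R p)
        (antichainsAbove-areAntichains p)
        λ m∈ → 1≮α (InIdeal⇒Large (∈-antichainsAbove⁻ m∈ α (α , α∈p , RootLe-refl)))

      h≡∑δ : fun (h R p) x ≡ fun (∑δ R (antichainsAbove R p)) x
      -- A with-abstraction here would normalise both functions.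
      h≡∑δ = cases (Fin.any? λ α → (α ∈? p) ×-dec ¬? (large? α))
        where
        cases : Dec (∃ λ α → α ∈ p × ¬ Large α) →
                fun (h R p) x ≡ fun (∑δ R (antichainsAbove R p)) x
        cases (yes (α , α∈p , 1≮α)) = trans (h-small α∈p 1≮α) (sym (∑δ-small α∈p 1≮α))
        cases (no ∄small)           = trans (h-large p-large) (sym (∑δ-large p-large))
          where
          p-large : ∀ {α} → α ∈ p → Large α
          p-large {α} α∈p = decidable-stable (large? α) λ 1≮α → ∄small (α , α∈p , 1≮α)

proposition7p1 : (X : DynkinType) (R : RootSystem X) (p : Subset (#Φ₊ R)) → IsAntichain R p →
    CommutativeRing._≈_ (H R) (h R p) (∑δ R (antichainsAbove R p))
-- Equality in `H R` is pointwise, so it is checked at each dominant point.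
proposition7p1 X R p _ x = h≡∑δ R x p
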